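{- Let $k\geq 2$ be an integer and let $G$ be an edge-colored graph on $n\geq 3k-2$ vertices. If $\delta^c(G)\geq \frac{n+k-1}{2}$, then $G$ contains $k$ rainbow triangles sharing one common edge.
   Context: An edge-colored graph is a simple graph $G$ with a coloring $c:E(G)\to\mathbb{N}$ of its edges (not necessarily proper). For a vertex $v$, the color degree $d^c(v)$ is the number of distinct colors appearing on edges incident with $v$, and $\delta^c(G)=\min\{d^c(v):v\in V(G)\}$. A triangle is rainbow if its three edges have pairwise distinct colors. -}

module Defs where

open import Data.Nat using (ℕ; _≟_)
open import Data.Fin using (Fin)
open import Data.List using (List; filter; map; length; deduplicate; allFin)
open import Relation.Nullary using (¬_; Dec)
open import Relation.Binary.PropositionalEquality using (_≡_)
open import Data.Product using (_×_)

record SimpleGraph (n : ℕ) : Set₁ where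
  field
    Adj     : Fin n → Fin n → Set
    adj?    : (u v : Fin n) → Dec (Adj u v)
    sym     : ∀ {u v} → Adj u v → Adj v u
    irrefl  : ∀ {u} → ¬ Adj u u

-- An edge coloring with colors in ℕ; c u v is the color of the edge uv.
-- Symmetry makes it a function on (unordered) edges; values on non-edges
-- are irrelevant.
record EdgeColoredGraph (n : ℕ) : Set₁ where
  field
    graph  : SimpleGraph n
    color  : Fin n → Fin n → ℕ
    color-sym : ∀ u v → color u v ≡ color v u
  open SimpleGraph graph public

open EdgeColoredGraph

neighbours : ∀ {n} (G : EdgeColoredGraph n) → Fin n → List (Fin n)
neighbours G v = filter (λ u → adj? G v u) (allFin _)

colorDegree : ∀ {n} (G : EdgeColoredGraph n) → Fin n → ℕ
colorDegree G v = length (deduplicate _≟_ (map (color G v) (neighbours G v)))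

RainbowTriangle : ∀ {n} (G : EdgeColoredGraph n) → Fin n → Fin n → Fin n → Set
RainbowTriangle G u v w =
  Adj G u v × Adj G v w × Adj G u w ×
  ¬ (color G u v ≡ color G v w) ×
  ¬ (color G v w ≡ color G u w) ×
  ¬ (color G u v ≡ color G u w)

{-# OPTIONS --safe #-}
module Submission where

open import Defs
open import Data.Nat using (ℕ; zero; suc; _+_; _*_; _∸_; _≤_; _<_; z≤n; s≤s; ⌈_/2⌉)
import Data.Nat as ℕ
open import Data.Nat.Properties hiding (_≟_; suc-injective; 0≢1+n)
open import Data.Nat.Tactic.RingSolver using (solve-∀)
open import Data.Nat.Induction using (<-wellFounded)
open import Induction.WellFounded using (Acc; acc)
open import Data.Bool using (if_then_else_)
open import Data.Fin using (Fin; zero; suc; _≟_; fromℕ<)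
open import Data.Fin.Properties using (suc-injective; 0≢1+n; any?)
open import Data.List using (List; []; _∷_; length; map; deduplicate; allFin)
open import Data.List.Membership.Propositional using (_∈_)
open import Data.List.Membership.Propositional.Properties using (∈-deduplicate⁻; ∈-map⁻; ∈-filter⁻)
open import Data.List.Relation.Unary.Any using (here; there)
open import Data.List.Relation.Unary.All using (lookup)
open import Data.List.Relation.Unary.AllPairs using (_∷_)
open import Data.List.Relation.Unary.Unique.Propositional using (Unique)
open import Data.List.Relation.Unary.Unique.DecPropositional.Properties ℕ._≟_ using (deduplicate-!)
open import Algebra.Properties.CommutativeMonoid.Sum +-0-commutativeMonoid using (sum; ∑-distrib-+; ∑-comm)
open import Data.Product using (Σ; ∃; _×_; _,_; proj₁; proj₂)
open import Data.Sum using (_⊎_; inj₁; inj₂; [_,_])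
open import Data.Unit using (tt)
open import Data.Empty using (⊥; ⊥-elim)
open import Function using (_∘_)
open import Function.Definitions using (Injective)
open import Relation.Nullary using (¬_; Dec; yes; no; does; ¬?; _×-dec_; _⊎-dec_)
open import Relation.Nullary.Decidable using (decidable-stable)
open import Relation.Binary.PropositionalEquality using (_≡_; _≢_; refl; sym; trans; cong; cong₂; subst; subst₂)

-- Delete edges that are redundant for the color degrees at both ends, until every monochromatic class
-- is a star forest.  Let d be the color degree bound and choose w and a color b such that the star S of
-- b-colored edges at w has the maximum number m of leaves; Q denotes the other neighbours of w.  For
-- y in Q, every common neighbour x of w and y reached from both in colors other than that of wy gives a
-- rainbow triangle, unless c(xy) = c(xw); call this an arc from x to y.  Inclusion-exclusion yields at
-- least 2d - n + m - 1 such x.  By maximality of m the arcs leaving a vertex number at most m - 1, so on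
-- average over Q the arcs cancel the gain from S and wy lies in 2d - n ≥ k - 1 rainbow triangles.
-- If no edge lies in k of them, every estimate is an equality.  Then Q has d - 1 elements, each of them
-- again the center of a maximum star, 2m ≤ d, and vertices outside the closed neighbourhood of w are
-- adjacent to all of Q.  This rigidity contradicts n ≥ 3k - 2, the decisive case being m = 1, where G
-- would be complete multipartite with at least three parts.

-- Linear arithmetic and finite sums.

-- Linear arithmetic by hand: the hypotheses are added up to a single `l ≤ r`, `c` is the part
-- common to both sides, and the two equations are left to the ring solver.
≤-from : ∀ {a b l r} c → l ≤ r → a + c ≡ l → b + c ≡ r → a ≤ b
≤-from {a} {b} c l≤r p q = +-cancelʳ-≤ c a b (subst₂ _≤_ (sym p) (sym q) l≤r)

sum-mono : ∀ {n} {f g : Fin n → ℕ} → (∀ i → f i ≤ g i) → sum f ≤ sum g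
sum-mono {zero} f≤g = z≤n
sum-mono {suc n} f≤g = +-mono-≤ (f≤g zero) (sum-mono (f≤g ∘ suc))

-- A strict inequality at one index could not be made up for at the others. This turns equality on
-- average into equality at every vertex.
sum-tight : ∀ {n} {f g : Fin n → ℕ} → (∀ i → f i ≤ g i) → sum g ≤ sum f → ∀ i → g i ≤ f i
sum-tight {suc n} {f} {g} f≤g Σg≤Σf zero =
  +-cancelʳ-≤ (sum (g ∘ suc)) _ _ (≤-trans Σg≤Σf (+-monoʳ-≤ (f zero) (sum-mono (f≤g ∘ suc))))
sum-tight {suc n} {f} {g} f≤g Σg≤Σf (suc i) = sum-tight (f≤g ∘ suc)
  (+-cancelˡ-≤ (g zero) _ _ (≤-trans Σg≤Σf (+-monoˡ-≤ (sum (f ∘ suc)) (f≤g zero)))) i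

sum-const : ∀ n {c} → sum {n} (λ _ → c) ≡ n * c
sum-const zero = refl
sum-const (suc n) {c} = cong (c +_) (sum-const n)

-- Indicators and counting of vertices.

𝟙 : {A : Set} → Dec A → ℕ
𝟙 a? = if does a? then 1 else 0

𝟙-yes : {A : Set} (a? : Dec A) → A → 𝟙 a? ≡ 1
𝟙-yes (yes _) _ = refl
𝟙-yes (no ¬a) a = ⊥-elim (¬a a)

𝟙-no : {A : Set} (a? : Dec A) → ¬ A → 𝟙 a? ≡ 0
𝟙-no (yes a) ¬a = ⊥-elim (¬a a)
𝟙-no (no _) _ = refl

𝟙≤1 : {A : Set} (a? : Dec A) → 𝟙 a? ≤ 1
𝟙≤1 (yes _) = ≤-refl
𝟙≤1 (no _) = z≤n

𝟙-mono : {A B : Set} (a? : Dec A) (b? : Dec B) → (A → B) → 𝟙 a? ≤ 𝟙 b?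
𝟙-mono (no _) b? f = z≤n
𝟙-mono (yes a) b? f = ≤-reflexive (sym (𝟙-yes b? (f a)))

𝟙-⊎ : {A B C : Set} (a? : Dec A) (b? : Dec B) (c? : Dec C) → (A → B ⊎ C) → 𝟙 a? ≤ 𝟙 b? + 𝟙 c?
𝟙-⊎ (no _) b? c? f = z≤n
𝟙-⊎ (yes a) b? c? f with f a
... | inj₁ b = ≤-trans (≤-reflexive (sym (𝟙-yes b? b))) (m≤m+n _ _)
... | inj₂ c = ≤-trans (≤-reflexive (sym (𝟙-yes c? c))) (m≤n+m _ _)

𝟙-disjoint : {A B C : Set} (a? : Dec A) (b? : Dec B) (c? : Dec C) →
  (A → C) → (B → C) → (A → ¬ B) → 𝟙 a? + 𝟙 b? ≤ 𝟙 c?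
𝟙-disjoint (no _) b? c? f g h = 𝟙-mono b? c? g
𝟙-disjoint (yes a) b? c? f g h rewrite 𝟙-no b? (h a) | 𝟙-yes c? (f a) = ≤-refl

𝟙-× : {A B : Set} (a? : Dec A) (b? : Dec B) → 𝟙 a? + 𝟙 b? ≤ 1 + 𝟙 (a? ×-dec b?)
𝟙-× (no _) b? = ≤-trans (𝟙≤1 b?) (m≤m+n _ _)
𝟙-× (yes a) (yes b) = ≤-refl
𝟙-× (yes a) (no b) = ≤-refl

count : ∀ {n} {P : Fin n → Set} → (∀ i → Dec (P i)) → ℕ
count P? = sum (λ i → 𝟙 (P? i))

sum-𝟙+𝟙 : ∀ {n} {P Q : Fin n → Set} (P? : ∀ i → Dec (P i)) (Q? : ∀ i → Dec (Q i)) →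
  sum (λ i → 𝟙 (P? i) + 𝟙 (Q? i)) ≡ count P? + count Q?
sum-𝟙+𝟙 {n} P? Q? = ∑-distrib-+ {n} (λ i → 𝟙 (P? i)) (λ i → 𝟙 (Q? i))

module _ {n : ℕ} {P Q : Fin n → Set} (P? : ∀ i → Dec (P i)) (Q? : ∀ i → Dec (Q i)) where

  count-mono : (∀ i → P i → Q i) → count P? ≤ count Q?
  count-mono P⇒Q = sum-mono λ i → 𝟙-mono (P? i) (Q? i) (P⇒Q i)

  -- Inclusion-exclusion with the union bounded by all `n` vertices.
  count-∩ : count P? + count Q? ≤ n + count (λ i → P? i ×-dec Q? i)
  count-∩ = begin
    count P? + count Q? ≡⟨ sum-𝟙+𝟙 P? Q? ⟨
    sum (λ i → 𝟙 (P? i) + 𝟙 (Q? i)) ≤⟨ sum-mono (λ i → 𝟙-× (P? i) (Q? i)) ⟩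
    sum (λ i → 1 + 𝟙 (P? i ×-dec Q? i)) ≡⟨ ∑-distrib-+ {n} (λ _ → 1) (λ i → 𝟙 (P? i ×-dec Q? i)) ⟩
    sum {n} (λ _ → 1) + count (λ i → P? i ×-dec Q? i) ≡⟨ cong (_+ count (λ i → P? i ×-dec Q? i)) (trans (sum-const n) (*-identityʳ n)) ⟩
    n + count (λ i → P? i ×-dec Q? i) ∎
    where open ≤-Reasoning

  module _ {R : Fin n → Set} (R? : ∀ i → Dec (R i)) where

    count-⊎ : (∀ i → P i → Q i ⊎ R i) → count P? ≤ count Q? + count R?
    count-⊎ f = ≤-trans (sum-mono λ i → 𝟙-⊎ (P? i) (Q? i) (R? i) (f i)) (≤-reflexive (sum-𝟙+𝟙 Q? R?))

    count-disjoint : (∀ i → P i → R i) → (∀ i → Q i → R i) → (∀ i → P i → ¬ Q i) →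
      count P? + count Q? ≤ count R?
    count-disjoint f g h = ≤-trans (≤-reflexive (sym (sum-𝟙+𝟙 P? Q?)))
      (sum-mono λ i → 𝟙-disjoint (P? i) (Q? i) (R? i) (f i) (g i) (h i))

module _ {n : ℕ} {P Q : Fin n → Set} (P? : ∀ i → Dec (P i)) (Q? : ∀ i → Dec (Q i)) where

  count-∪ : count (λ i → P? i ⊎-dec Q? i) ≤ count P? + count Q?
  count-∪ = count-⊎ (λ i → P? i ⊎-dec Q? i) P? Q? (λ _ p → p)

  count-∪-disjoint : (∀ i → P i → ¬ Q i) → count P? + count Q? ≤ count (λ i → P? i ⊎-dec Q? i)
  count-∪-disjoint = count-disjoint P? Q? (λ i → P? i ⊎-dec Q? i) (λ _ → inj₁) (λ _ → inj₂)

count-empty : ∀ {n} {P : Fin n → Set} (P? : ∀ i → Dec (P i)) → (∀ i → ¬ P i) → count P? ≡ 0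
count-empty {zero} P? ¬P = refl
count-empty {suc n} P? ¬P = cong₂ _+_ (𝟙-no (P? zero) (¬P zero)) (count-empty (P? ∘ suc) (¬P ∘ suc))

count-full : ∀ {n} {P : Fin n → Set} (P? : ∀ i → Dec (P i)) → (∀ i → P i) → count P? ≡ n
count-full {zero} P? p = refl
count-full {suc n} P? p = cong₂ _+_ (𝟙-yes (P? zero) (p zero)) (count-full (P? ∘ suc) (p ∘ suc))

count-∃⁺ : ∀ {n} {P : Fin n → Set} (P? : ∀ i → Dec (P i)) i → P i → 1 ≤ count P?
count-∃⁺ P? zero p = ≤-trans (≤-reflexive (sym (𝟙-yes (P? zero) p))) (m≤m+n _ _)
count-∃⁺ P? (suc i) p = ≤-trans (count-∃⁺ (P? ∘ suc) i p) (m≤n+m _ _)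

count-∃⁻ : ∀ {n} {P : Fin n → Set} (P? : ∀ i → Dec (P i)) → 1 ≤ count P? → ∃ P
count-∃⁻ P? 1≤#P with any? P?
... | yes ∃P = ∃P
... | no ∄P = ⊥-elim (<⇒≱ 1≤#P (≤-reflexive (count-empty P? λ i p → ∄P (i , p))))

count-unique : ∀ {n} {P : Fin n → Set} (P? : ∀ i → Dec (P i)) → (∀ i j → P i → P j → i ≡ j) → count P? ≤ 1
count-unique {zero} P? u = z≤n
count-unique {suc n} P? u with P? zero
... | yes p = ≤-reflexive (cong suc (count-empty (P? ∘ suc) λ i q → 0≢1+n (u zero (suc i) p q)))
... | no _ = count-unique (P? ∘ suc) λ i j p q → suc-injective (u (suc i) (suc j) p q)

count-≡ : ∀ {n} (x : Fin n) → count (_≟ x) ≡ 1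
count-≡ x = ≤-antisym (count-unique (_≟ x) λ i j p q → trans p (sym q)) (count-∃⁺ (_≟ x) x refl)

count-other : ∀ {n} {P : Fin n → Set} (P? : ∀ i → Dec (P i)) → 2 ≤ count P? → ∀ x → ∃ λ y → P y × y ≢ x
count-other {P = P} P? 2≤#P x = count-∃⁻ P≢x? (+-cancelʳ-≤ 1 _ _ (begin
  2 ≤⟨ 2≤#P ⟩
  count P? ≤⟨ count-⊎ P? P≢x? (_≟ x) split ⟩
  count P≢x? + count (_≟ x) ≡⟨ cong (count P≢x? +_) (count-≡ x) ⟩
  count P≢x? + 1 ∎))
  where
  open ≤-Reasoning
  P≢x? : ∀ y → Dec (P y × y ≢ x)
  P≢x? y = P? y ×-dec ¬? (y ≟ x)
  split : ∀ y → P y → (P y × y ≢ x) ⊎ y ≡ x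
  split y p with y ≟ x
  ... | yes y≡x = inj₂ y≡x
  ... | no y≢x = inj₁ (p , y≢x)

count-pair : ∀ {n} {P : Fin n → Set} (P? : ∀ i → Dec (P i)) {x y} → P x → P y → x ≢ y → 2 ≤ count P?
count-pair P? {x} {y} px py x≢y = subst (_≤ count P?) (cong₂ _+_ (count-≡ x) (count-≡ y))
  (count-disjoint (_≟ x) (_≟ y) P? (λ { _ refl → px }) (λ { _ refl → py }) λ { _ refl → x≢y })

-- Converts a count of rainbow triangles into the injective family that the theorem asks for.
enumerate : ∀ {n} {P : Fin n → Set} (P? : ∀ i → Dec (P i)) k → k ≤ count P? →
  Σ (Fin k → Fin n) λ w → Injective _≡_ _≡_ w × (∀ i → P (w i))
enumerate P? zero _ = (λ ()) , (λ { {()} }) , λ ()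
enumerate {suc n} {P} P? (suc k) k<#P with P? zero
... | yes p = w , w-inj , w∈P
  where
  rest = enumerate (P? ∘ suc) k (≤-pred k<#P)
  w : Fin (suc k) → Fin (suc n)
  w zero = zero
  w (suc i) = suc (proj₁ rest i)
  w-inj : Injective _≡_ _≡_ w
  w-inj {zero} {zero} _ = refl
  w-inj {suc i} {suc j} e = cong suc (proj₁ (proj₂ rest) (suc-injective e))
  w∈P : ∀ i → P (w i)
  w∈P zero = p
  w∈P (suc i) = proj₂ (proj₂ rest) i
... | no _ with enumerate (P? ∘ suc) (suc k) k<#P
...   | w , w-inj , w∈P = suc ∘ w , w-inj ∘ suc-injective , w∈P

-- Distinct values need distinct preimages: the preimage `x` of the head is removed from `P`, and no
-- later value can require it because the list has no repetitions.
length-≤-count : ∀ {n} (f : Fin n → ℕ) {P : Fin n → Set} (P? : ∀ i → Dec (P i)) (as : List ℕ) → Unique as →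
  (∀ {a} → a ∈ as → ∃ λ x → P x × f x ≡ a) → length as ≤ count P?
length-≤-count f P? [] _ _ = z≤n
length-≤-count f {P} P? (a ∷ as) (a∉as ∷ as!) hit with hit (here refl)
... | x , px , fx≡a = begin
  1 + length as ≤⟨ +-monoʳ-≤ 1 (length-≤-count f P≢x? as as! hit′) ⟩
  1 + count P≢x? ≡⟨ cong (_+ count P≢x?) (count-≡ x) ⟨
  count (_≟ x) + count P≢x? ≤⟨ count-disjoint (_≟ x) P≢x? P? (λ { _ refl → px }) (λ _ → proj₁) (λ _ e p → proj₂ p e) ⟩
  count P? ∎
  where
  open ≤-Reasoning
  P≢x? : ∀ y → Dec (P y × y ≢ x)
  P≢x? y = P? y ×-dec ¬? (y ≟ x)
  hit′ : ∀ {b} → b ∈ as → ∃ λ y → (P y × y ≢ x) × f y ≡ b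
  hit′ b∈as with hit (there b∈as)
  ... | y , py , fy≡b = y , (py , λ { refl → lookup a∉as b∈as (trans (sym fx≡a) fy≡b) }) , fy≡b

-- Color classes at a vertex and extremal counterexamples.

module _ {n : ℕ} (G : EdgeColoredGraph n) where
  open EdgeColoredGraph G renaming (sym to adj-sym)

  Mono : Fin n → ℕ → Fin n → Set
  Mono v a x = Adj v x × color v x ≡ a

  mono? : ∀ v a x → Dec (Mono v a x)
  mono? v a x = adj? v x ×-dec (color v x ℕ.≟ a)

  self-mono : ∀ {v x} → Adj v x → 1 ≤ count (mono? v (color v x))
  self-mono {v} {x} v~x = count-∃⁺ (mono? v (color v x)) x (v~x , refl)

  rainbow? : ∀ u v w → Dec (RainbowTriangle G u v w)
  rainbow? u v w = adj? u v ×-dec adj? v w ×-dec adj? u w ×-dec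
    ¬? (color u v ℕ.≟ color v w) ×-dec ¬? (color v w ℕ.≟ color u w) ×-dec ¬? (color u v ℕ.≟ color u w)

  -- Representatives for the colors at `v`. They are compared by color value alone, so a hitting set
  -- can be carried from one edge set to another on the same coloring.
  HitsColors : Fin n → (Fin n → Set) → Set
  HitsColors v B = ∀ x → Adj v x → ∃ λ y → B y × color v y ≡ color v x

  -- Under this condition, deleting `uv` costs `u` no color.
  Doubled : Fin n → Fin n → Set
  Doubled u v = ∃ λ x → Mono u (color u v) x × x ≢ v

  -- Stated through hitting sets, a lower bound on color degrees survives edge deletion without recounting.
  record Counterexample (d k : ℕ) : Set₁ where
    field
      degree : ∀ v {B} (B? : ∀ x → Dec (B x)) → HitsColors v B → d ≤ count B?
      few-rainbow : ∀ u v → Adj u v → count (rainbow? u v) ≤ k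

  -- `reduced` is the star forest condition. Star sizes are bounded by `suc s`, so that `s` is the
  -- number of leaves besides a given one.
  record Extremal (d k s : ℕ) : Set₁ where
    field
      counterexample : Counterexample d k
      dense : n + k ≤ d + d
      reduced : ∀ u v → Adj u v → Doubled u v → ¬ Doubled v u
      bound : ∀ v u → Adj v u → count (mono? v (color v u)) ≤ suc s
    open Counterexample counterexample public

-- Counting around a center `w` of a maximum star.

module Base {n d k s : ℕ} (G : EdgeColoredGraph n) (E : Extremal G d k s)
  {w u : Fin n} (w~u : EdgeColoredGraph.Adj G w u)
  (full : suc s ≤ count (mono? G w (EdgeColoredGraph.color G w u))) where
  open EdgeColoredGraph G renaming (sym to adj-sym)
  open Extremal E

  b : ℕ
  b = color w u

  Q : Fin n → Set
  Q x = Adj w x × color w x ≢ b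

  Q? : ∀ x → Dec (Q x)
  Q? x = adj? w x ×-dec ¬? (color w x ℕ.≟ b)

  Arc : Fin n → Fin n → Set
  Arc x y = Q x × Q y × Mono G x (color w x) y

  arc? : ∀ x y → Dec (Arc x y)
  arc? x y = Q? x ×-dec Q? y ×-dec mono? G x (color w x) y

  indegree outdegree : Fin n → ℕ
  indegree y = count (λ x → arc? x y)
  outdegree x = count (arc? x)

  -- With a second edge of color `b` at `x`, `bound` at `x` gives `2 ≤ suc s`. Then the maximum star
  -- at `w` has a second leaf too, and the color of `wx` is repeated at both ends, against
  -- `reduced`.
  S-leaf : ∀ {x y} → Adj w x → color w x ≡ b → Adj x y → color x y ≡ b → y ≢ w → ⊥
  S-leaf {x} {y} w~x wx≡b x~y xy≡b y≢w = reduced w x w~x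
    (let z , (w~z , wz≡b) , z≢x = count-other (mono? G w b) (≤-trans 2≤ (≤-trans bnd full)) x
     in z , (w~z , trans wz≡b (sym wx≡b)) , z≢x)
    (y , (x~y , trans xy≡b (sym (trans (color-sym x w) wx≡b))) , y≢w)
    where
    2≤ : 2 ≤ count (mono? G x (color x w))
    2≤ = count-pair (mono? G x (color x w)) {w} {y} (adj-sym w~x , refl)
      (x~y , trans xy≡b (sym (trans (color-sym x w) wx≡b))) (y≢w ∘ sym)
    bnd = bound x w (adj-sym w~x)

  module At {y : Fin n} (y∈Q : Q y) where
    w~y = proj₁ y∈Q
    a = color w y
    a≢b = proj₂ y∈Q

    -- `Z` collects the non-neighbours of `w` that `B` misses. It is kept in the count as slack, so
    -- that equality later forces it to be empty.
    B Qₐ Z : Fin n → Set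
    B x = Adj y x × color y x ≢ a
    Qₐ x = Q x × color w x ≢ a
    Z x = ¬ Adj w x × x ≢ w × ¬ B x

    B? : ∀ x → Dec (B x)
    B? x = adj? y x ×-dec ¬? (color y x ℕ.≟ a)

    Qₐ? : ∀ x → Dec (Qₐ x)
    Qₐ? x = Q? x ×-dec ¬? (color w x ℕ.≟ a)

    Z? : ∀ x → Dec (Z x)
    Z? x = ¬? (adj? w x) ×-dec ¬? (x ≟ w) ×-dec ¬? (B? x)

    w≡y⊥ : w ≢ y
    w≡y⊥ refl = irrefl w~y

    -- The vertex `w` represents the one color at `y` that `B` leaves out.
    d≤#B+1 : d ≤ count B? + 1
    d≤#B+1 = begin
      d ≤⟨ degree y (λ x → B? x ⊎-dec (x ≟ w)) hits ⟩
      count (λ x → B? x ⊎-dec (x ≟ w)) ≤⟨ count-∪ B? (_≟ w) ⟩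
      count B? + count (_≟ w) ≡⟨ cong (count B? +_) (count-≡ w) ⟩
      count B? + 1 ∎
      where
      open ≤-Reasoning
      hits : HitsColors G y (λ x → B x ⊎ x ≡ w)
      hits x y~x with color y x ℕ.≟ a
      ... | yes yx≡a = w , inj₂ refl , trans (color-sym y w) (sym yx≡a)
      ... | no yx≢a = x , inj₁ (y~x , yx≢a) , refl

    d≤#Qₐ+2 : d ≤ count Qₐ? + 2
    d≤#Qₐ+2 = begin
      d ≤⟨ degree w U? hits ⟩
      count U? ≤⟨ count-∪ Qₐ? (λ x → (x ≟ y) ⊎-dec (x ≟ u)) ⟩
      count Qₐ? + count (λ x → (x ≟ y) ⊎-dec (x ≟ u)) ≤⟨ +-monoʳ-≤ (count Qₐ?) (count-∪ (_≟ y) (_≟ u)) ⟩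
      count Qₐ? + (count (_≟ y) + count (_≟ u)) ≡⟨ cong (count Qₐ? +_) (cong₂ _+_ (count-≡ y) (count-≡ u)) ⟩
      count Qₐ? + 2 ∎
      where
      open ≤-Reasoning
      U? : ∀ x → Dec (Qₐ x ⊎ x ≡ y ⊎ x ≡ u)
      U? x = Qₐ? x ⊎-dec (x ≟ y) ⊎-dec (x ≟ u)
      hits : HitsColors G w (λ x → Qₐ x ⊎ x ≡ y ⊎ x ≡ u)
      hits x w~x with color w x ℕ.≟ a | color w x ℕ.≟ b
      ... | yes wx≡a | _ = y , inj₂ (inj₁ refl) , sym wx≡a
      ... | no _ | yes wx≡b = u , inj₂ (inj₂ refl) , sym wx≡b
      ... | no wx≢a | no wx≢b = x , inj₁ ((w~x , wx≢b) , wx≢a) , refl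

    -- The vertices `w`, `y` and those of `Z` lie outside `B`. Each of them adds one to `U` and
    -- nothing to the intersection, which sharpens the inclusion-exclusion.
    U : Fin n → Set
    U x = Z x ⊎ Qₐ x ⊎ Mono G w b x ⊎ x ≡ w ⊎ x ≡ y

    U? : ∀ x → Dec (U x)
    U? x = Z? x ⊎-dec Qₐ? x ⊎-dec mono? G w b x ⊎-dec (x ≟ w) ⊎-dec (x ≟ y)

    #U : count Z? + (count Qₐ? + (suc s + 2)) ≤ count U?
    #U = begin
      count Z? + (count Qₐ? + (suc s + 2))
        ≤⟨ +-monoʳ-≤ (count Z?) (+-monoʳ-≤ (count Qₐ?) (+-mono-≤ full
          (≤-trans (≤-reflexive (cong₂ _+_ (sym (count-≡ w)) (sym (count-≡ y))))
            (count-∪-disjoint (_≟ w) (_≟ y) λ { _ refl e → w≡y⊥ e })))) ⟩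
      count Z? + (count Qₐ? + (count (mono? G w b) + count U₁?))
        ≤⟨ +-monoʳ-≤ (count Z?) (+-monoʳ-≤ (count Qₐ?) (count-∪-disjoint (mono? G w b) U₁?
          λ { _ (w~w , _) (inj₁ refl) → irrefl w~w ; _ (_ , a≡b) (inj₂ refl) → a≢b a≡b })) ⟩
      count Z? + (count Qₐ? + count U₂?)
        ≤⟨ +-monoʳ-≤ (count Z?) (count-∪-disjoint Qₐ? U₂?
          λ { _ ((_ , ≢b) , _) (inj₁ (_ , ≡b)) → ≢b ≡b
            ; _ ((w~w , _) , _) (inj₂ (inj₁ refl)) → irrefl w~w
            ; _ (_ , ≢a) (inj₂ (inj₂ refl)) → ≢a refl }) ⟩
      count Z? + count (λ x → Qₐ? x ⊎-dec U₂? x)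
        ≤⟨ count-∪-disjoint Z? (λ x → Qₐ? x ⊎-dec U₂? x)
          (λ { _ (≁w , _) (inj₁ ((w~ , _) , _)) → ≁w w~
             ; _ (≁w , _) (inj₂ (inj₁ (w~ , _))) → ≁w w~
             ; _ (_ , ≢w , _) (inj₂ (inj₂ (inj₁ ≡w))) → ≢w ≡w
             ; _ (≁w , _) (inj₂ (inj₂ (inj₂ refl))) → ≁w w~y }) ⟩
      count U? ∎
      where
      open ≤-Reasoning
      U₁? : ∀ x → Dec (x ≡ w ⊎ x ≡ y)
      U₁? x = (x ≟ w) ⊎-dec (x ≟ y)
      U₂? : ∀ x → Dec (Mono G w b x ⊎ x ≡ w ⊎ x ≡ y)
      U₂? x = mono? G w b x ⊎-dec U₁? x

    -- On `Qₐ` the triangle can fail to be rainbow only if `xy` has the color of `wx`, which is an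
    -- arc. For leaves of the star of color `b`, `S-leaf` excludes this coincidence.
    B∩U : ∀ x → B x × U x → RainbowTriangle G w y x ⊎ Arc x y
    B∩U x (x∈B , inj₁ (_ , _ , x∉B)) = ⊥-elim (x∉B x∈B)
    B∩U x ((y~x , yx≢a) , inj₂ (inj₁ ((w~x , wx≢b) , wx≢a))) with color y x ℕ.≟ color w x
    ... | yes yx≡wx = inj₂ ((w~x , wx≢b) , y∈Q , adj-sym y~x , trans (color-sym x y) yx≡wx)
    ... | no yx≢wx = inj₁ (w~y , y~x , w~x , yx≢a ∘ sym , yx≢wx , wx≢a ∘ sym)
    B∩U x ((y~x , yx≢a) , inj₂ (inj₂ (inj₁ (w~x , wx≡b)))) = inj₁
      ( w~y , y~x , w~x , yx≢a ∘ sym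
      , (λ yx≡wx → S-leaf w~x wx≡b (adj-sym y~x) (trans (color-sym x y) (trans yx≡wx wx≡b)) (w≡y⊥ ∘ sym))
      , λ a≡wx → a≢b (trans a≡wx wx≡b))
    B∩U x ((_ , yw≢a) , inj₂ (inj₂ (inj₂ (inj₁ refl)))) = ⊥-elim (yw≢a (color-sym y w))
    B∩U x ((y~y , _) , inj₂ (inj₂ (inj₂ (inj₂ refl)))) = ⊥-elim (irrefl y~y)

    T : ℕ
    T = count (rainbow? G w y)

    main-count : count B? + (count Z? + (count Qₐ? + (suc s + 2))) ≤ n + (T + indegree y)
    main-count = begin
      count B? + (count Z? + (count Qₐ? + (suc s + 2))) ≤⟨ +-monoʳ-≤ (count B?) #U ⟩
      count B? + count U? ≤⟨ count-∩ B? U? ⟩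
      n + count (λ x → B? x ×-dec U? x) ≤⟨ +-monoʳ-≤ n (count-⊎ (λ x → B? x ×-dec U? x) (rainbow? G w y) (λ x → arc? x y) B∩U) ⟩
      n + (T + indegree y) ∎
      where open ≤-Reasoning

    T≤k : T ≤ k
    T≤k = few-rainbow w y w~y

    -- Since `B` has at least d - 1 elements and `Qₐ` at least d - 2, `main-count` and `T≤k` give 2d
    -- + s ≤ n + k + `indegree y`, while `dense` gives n + k ≤ 2d.
    s≤indegree : s ≤ indegree y
    s≤indegree = ≤-from (n + k + (count B? + count Qₐ? + 3 + count Z? + (d + d) + T))
      (+-mono-≤ main-count (+-mono-≤ dense (+-mono-≤ d≤#B+1 (+-mono-≤ d≤#Qₐ+2 (+-mono-≤ T≤k (z≤n {count Z?}))))))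
      (eq₁ s n k (count B?) (count Qₐ?) (count Z?) d T) (eq₂ (indegree y) n k (count B?) (count Qₐ?) (count Z?) d T)
      where
      eq₁ : ∀ s n k β α ζ d t → s + (n + k + (β + α + 3 + ζ + (d + d) + t)) ≡ β + (ζ + (α + (suc s + 2))) + (n + k + (d + (d + (t + 0))))
      eq₁ = solve-∀
      eq₂ : ∀ i n k β α ζ d t → i + (n + k + (β + α + 3 + ζ + (d + d) + t)) ≡ n + (t + i) + (d + d + (β + 1 + (α + 2 + (k + ζ))))
      eq₂ = solve-∀

    -- With indegree at most `s`, the chain behind `s≤indegree` has no slack. Each inequality below
    -- is the converse of one estimate in it, obtained by adding up the other estimates.
    module Tight (indegree≤s : indegree y ≤ s) where

      #Z≡0 : count Z? ≤ 0
      #Z≡0 = ≤-from (s + n + k + (count B? + count Qₐ? + 3 + (d + d) + T + indegree y))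
        (+-mono-≤ main-count (+-mono-≤ dense (+-mono-≤ d≤#B+1 (+-mono-≤ d≤#Qₐ+2 (+-mono-≤ T≤k indegree≤s)))))
        (eq₁ s n k (count B?) (count Qₐ?) (count Z?) d T (indegree y)) (eq₂ s n k (count B?) (count Qₐ?) d T (indegree y))
        where
        eq₁ : ∀ s n k β α ζ d t i → ζ + (s + n + k + (β + α + 3 + (d + d) + t + i)) ≡ β + (ζ + (α + (suc s + 2))) + (n + k + (d + (d + (t + i))))
        eq₁ = solve-∀
        eq₂ : ∀ s n k β α d t i → 0 + (s + n + k + (β + α + 3 + (d + d) + t + i)) ≡ n + (t + i) + (d + d + (β + 1 + (α + 2 + (k + s))))
        eq₂ = solve-∀

      k≤T : k ≤ T
      k≤T = ≤-from (s + n + (count B? + count Qₐ? + 3 + (d + d) + indegree y + count Z?))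
        (+-mono-≤ main-count (+-mono-≤ dense (+-mono-≤ d≤#B+1 (+-mono-≤ d≤#Qₐ+2 (+-mono-≤ indegree≤s (z≤n {count Z?}))))))
        (eq₁ s n k (count B?) (count Qₐ?) (count Z?) d (indegree y)) (eq₂ s n T (count B?) (count Qₐ?) (count Z?) d (indegree y))
        where
        eq₁ : ∀ s n k β α ζ d i → k + (s + n + (β + α + 3 + (d + d) + i + ζ)) ≡ β + (ζ + (α + (suc s + 2))) + (n + k + (d + (d + (i + 0))))
        eq₁ = solve-∀
        eq₂ : ∀ s n t β α ζ d i → t + (s + n + (β + α + 3 + (d + d) + i + ζ)) ≡ n + (t + i) + (d + d + (β + 1 + (α + 2 + (s + ζ))))
        eq₂ = solve-∀

      2d≤n+k : d + d ≤ n + k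
      2d≤n+k = ≤-from (s + (count B? + count Qₐ? + 3 + T + indegree y + count Z?))
        (+-mono-≤ main-count (+-mono-≤ d≤#B+1 (+-mono-≤ d≤#Qₐ+2 (+-mono-≤ T≤k (+-mono-≤ indegree≤s (z≤n {count Z?}))))))
        (eq₁ s (count B?) (count Qₐ?) (count Z?) d T (indegree y)) (eq₂ s n k (count B?) (count Qₐ?) (count Z?) T (indegree y))
        where
        eq₁ : ∀ s β α ζ d t i → d + d + (s + (β + α + 3 + t + i + ζ)) ≡ β + (ζ + (α + (suc s + 2))) + (d + (d + (t + (i + 0))))
        eq₁ = solve-∀
        eq₂ : ∀ s n k β α ζ t i → n + k + (s + (β + α + 3 + t + i + ζ)) ≡ n + (t + i) + (β + 1 + (α + 2 + (k + (s + ζ))))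
        eq₂ = solve-∀

      #Qₐ+2≤d : count Qₐ? + 2 ≤ d
      #Qₐ+2≤d = ≤-from (s + n + k + (count B? + 1 + d + T + indegree y + count Z?))
        (+-mono-≤ main-count (+-mono-≤ dense (+-mono-≤ d≤#B+1 (+-mono-≤ T≤k (+-mono-≤ indegree≤s (z≤n {count Z?}))))))
        (eq₁ s n k (count B?) (count Qₐ?) (count Z?) d T (indegree y)) (eq₂ s n k (count B?) (count Z?) d T (indegree y))
        where
        eq₁ : ∀ s n k β α ζ d t i → α + 2 + (s + n + k + (β + 1 + d + t + i + ζ)) ≡ β + (ζ + (α + (suc s + 2))) + (n + k + (d + (t + (i + 0))))
        eq₁ = solve-∀
        eq₂ : ∀ s n k β ζ d t i → d + (s + n + k + (β + 1 + d + t + i + ζ)) ≡ n + (t + i) + (d + d + (β + 1 + (k + (s + ζ))))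
        eq₂ = solve-∀

      nonneighbour : ∀ {z} → z ≢ w → ¬ Adj w z → B z
      nonneighbour {z} z≢w w≁z = decidable-stable (B? z) λ z∉B →
        <⇒≱ (count-∃⁺ Z? z (w≁z , z≢w , z∉B)) #Z≡0

  -- Double counting of arcs.

  -- All arcs leaving `x` lie in the star at `x` with the color of `xw`, and `w` is a further leaf
  -- of that star.
  outdegree<#mono : ∀ {x} → Q x → outdegree x + 1 ≤ count (mono? G x (color x w))
  outdegree<#mono {x} (w~x , _) = subst (λ m → outdegree x + m ≤ count (mono? G x (color x w))) (count-≡ w)
    (count-disjoint (arc? x) (_≟ w) (mono? G x (color x w))
      (λ { _ (_ , _ , x~y , xy≡wx) → x~y , trans xy≡wx (color-sym w x) })
      (λ { _ refl → adj-sym w~x , refl })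
      (λ { _ (_ , (w~w , _) , _) refl → irrefl w~w }))

  outdegree≤s : ∀ {x} → Q x → outdegree x ≤ s
  outdegree≤s {x} x∈Q = +-cancelʳ-≤ 1 _ _ (≤-trans (outdegree<#mono x∈Q)
    (≤-trans (bound x w (adj-sym (proj₁ x∈Q))) (≤-reflexive (+-comm 1 s))))

  -- The common lower bound for indegrees and upper bound for outdegrees, extended by 0 outside `Q`
  -- so that sums run over all vertices.
  share : Fin n → ℕ
  share x = 𝟙 (Q? x) * s

  share≡s : ∀ {x} → Q x → share x ≡ s
  share≡s {x} x∈Q = trans (cong (_* s) (𝟙-yes (Q? x) x∈Q)) (+-identityʳ s)

  share≤indegree : ∀ y → share y ≤ indegree y
  share≤indegree y = case (Q? y)
    where
    case : (q? : Dec (Q y)) → 𝟙 q? * s ≤ indegree y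
    case (yes y∈Q) = ≤-trans (≤-reflexive (+-identityʳ s)) (At.s≤indegree y∈Q)
    case (no _) = z≤n

  outdegree≤share : ∀ x → outdegree x ≤ share x
  outdegree≤share x = case (Q? x)
    where
    case : (q? : Dec (Q x)) → outdegree x ≤ 𝟙 q? * s
    case (yes x∈Q) = ≤-trans (outdegree≤s x∈Q) (≤-reflexive (sym (+-identityʳ s)))
    case (no x∉Q) = ≤-reflexive (count-empty (arc? x) λ _ → x∉Q ∘ proj₁)

  Σindegree≡Σoutdegree : sum indegree ≡ sum outdegree
  Σindegree≡Σoutdegree = ∑-comm (λ y x → 𝟙 (arc? x y))

  -- Both degree sums count the arcs, so the sum of `share` is squeezed between itself and
  -- `sum-tight` gives equality at each vertex.
  indegree≤s : ∀ {y} → Q y → indegree y ≤ s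
  indegree≤s {y} y∈Q = ≤-trans (sum-tight share≤indegree
    (≤-trans (≤-reflexive Σindegree≡Σoutdegree) (sum-mono outdegree≤share)) y) (≤-reflexive (share≡s y∈Q))

  s≤outdegree : ∀ {y} → Q y → s ≤ outdegree y
  s≤outdegree {y} y∈Q = ≤-trans (≤-reflexive (sym (share≡s y∈Q))) (sum-tight outdegree≤share
    (≤-trans (sum-mono share≤indegree) (≤-reflexive Σindegree≡Σoutdegree)) y)

  -- Rigidity of the equality case.

  module _ {y : Fin n} (y∈Q : Q y) where
    open At y∈Q
    open Tight (indegree≤s y∈Q) public

    -- The `s` arcs leaving `y` together with the edge `yw` form a maximum star, so the analysis can
    -- be restarted with `y` as center.
    full-y : suc s ≤ count (mono? G y (color y w))
    full-y = ≤-trans (≤-reflexive (+-comm 1 s)) (≤-trans (+-monoˡ-≤ 1 (s≤outdegree y∈Q)) (outdegree<#mono y∈Q))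

    -- For `s = 0` this is `bound`. Otherwise an arc leaves `y` and repeats the color of `wy` there,
    -- so `reduced` forbids repeating it at `w`.
    unique-color : ∀ {x} → Mono G w (color w y) x → x ≡ y
    unique-color {x} (w~x , wx≡wy) = decidable-stable (x ≟ y) λ x≢y → unique x≢y (s ℕ.≟ 0)
      where
      unique : x ≢ y → Dec (s ≡ 0) → ⊥
      unique x≢y (yes refl) = <⇒≱ (count-pair (mono? G w (color w y)) (w~x , wx≡wy) (w~y , refl) x≢y) (bound w y w~y)
      unique x≢y (no s≢0) with count-∃⁻ (arc? y) (≤-trans (n≢0⇒n>0 s≢0) (s≤outdegree y∈Q))
      ... | v , _ , (w~v , _) , y~v , yv≡wy = reduced w y w~y (x , (w~x , wx≡wy) , x≢y)
        (v , (y~v , trans yv≡wy (color-sym w y)) , λ { refl → irrefl w~v })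

    Q-split : ∀ x → Q x → Qₐ x ⊎ x ≡ y
    Q-split x x∈Q with color w x ℕ.≟ color w y
    ... | yes wx≡wy = inj₂ (unique-color (proj₁ x∈Q , wx≡wy))
    ... | no wx≢wy = inj₁ (x∈Q , wx≢wy)

    #Q<d : count Q? + 1 ≤ d
    #Q<d = begin
      count Q? + 1 ≤⟨ +-monoˡ-≤ 1 (count-⊎ Q? Qₐ? (_≟ y) Q-split) ⟩
      count Qₐ? + count (_≟ y) + 1 ≡⟨ cong (λ m → count Qₐ? + m + 1) (count-≡ y) ⟩
      count Qₐ? + 1 + 1 ≡⟨ +-assoc (count Qₐ?) 1 1 ⟩
      count Qₐ? + 2 ≤⟨ #Qₐ+2≤d ⟩
      d ∎
      where open ≤-Reasoning

    -- No two vertices of Q are joined by arcs both ways, since they see w in different colors.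
    2s≤d : suc s + suc s ≤ d
    2s≤d = begin
      suc s + suc s ≡⟨ eq s ⟩
      (s + s) + 2 ≤⟨ +-monoˡ-≤ 2 (+-mono-≤ s≤indegree (s≤outdegree y∈Q)) ⟩
      (indegree y + outdegree y) + 2 ≤⟨ +-monoˡ-≤ 2 (count-disjoint (λ x → arc? x y) (arc? y) Qₐ? in⇒ out⇒ one-way) ⟩
      count Qₐ? + 2 ≤⟨ #Qₐ+2≤d ⟩
      d ∎
      where
      open ≤-Reasoning
      eq : ∀ s → suc s + suc s ≡ (s + s) + 2
      eq = solve-∀
      in⇒ : ∀ x → Arc x y → Qₐ x
      in⇒ x (x∈Q , _ , x~y , _) = x∈Q , λ wx≡wy →
        irrefl (subst (λ v → Adj v y) (unique-color (proj₁ x∈Q , wx≡wy)) x~y)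
      out⇒ : ∀ x → Arc y x → Qₐ x
      out⇒ x (_ , x∈Q , y~x , _) = x∈Q , λ wx≡wy →
        irrefl (subst (Adj y) (unique-color (proj₁ x∈Q , wx≡wy)) y~x)
      one-way : ∀ x → Arc x y → ¬ Arc y x
      one-way x p@(_ , _ , _ , xy≡wx) (_ , _ , _ , yx≡wy) =
        proj₂ (in⇒ x p) (trans (sym xy≡wx) (trans (color-sym x y) yx≡wy))

  d≤#Q+1 : d ≤ count Q? + 1
  d≤#Q+1 = begin
    d ≤⟨ degree w (λ x → Q? x ⊎-dec (x ≟ u)) hits ⟩
    count (λ x → Q? x ⊎-dec (x ≟ u)) ≤⟨ count-∪ Q? (_≟ u) ⟩
    count Q? + count (_≟ u) ≡⟨ cong (count Q? +_) (count-≡ u) ⟩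
    count Q? + 1 ∎
    where
    open ≤-Reasoning
    hits : HitsColors G w (λ x → Q x ⊎ x ≡ u)
    hits x w~x with color w x ℕ.≟ b
    ... | yes wx≡b = u , inj₂ refl , sym wx≡b
    ... | no wx≢b = x , inj₁ (w~x , wx≢b) , refl

  Q-inhabited : 2 ≤ d → ∃ Q
  Q-inhabited 2≤d = count-∃⁻ Q? (+-cancelʳ-≤ 1 _ _ (≤-trans 2≤d d≤#Q+1))

  #neighbours≤d+s : ∀ {y} → Q y → count (adj? w) ≤ d + s
  #neighbours≤d+s y∈Q = begin
    count (adj? w) ≤⟨ count-⊎ (adj? w) Q? (mono? G w b) split ⟩
    count Q? + count (mono? G w b) ≤⟨ +-monoʳ-≤ (count Q?) (bound w u w~u) ⟩
    count Q? + suc s ≡⟨ +-assoc (count Q?) 1 s ⟨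
    count Q? + 1 + s ≤⟨ +-monoˡ-≤ s (#Q<d y∈Q) ⟩
    d + s ∎
    where
    open ≤-Reasoning
    split : ∀ x → Adj w x → Q x ⊎ Mono G w b x
    split x w~x with color w x ℕ.≟ b
    ... | yes wx≡b = inj₂ (w~x , wx≡b)
    ... | no wx≢b = inj₁ (w~x , wx≢b)

-- Contradiction from rigidity.

module _ {n d k s : ℕ} (G : EdgeColoredGraph n) (E : Extremal G d k s) (0<k : 0 < k) (3k<n : k + k + k < n) where
  open EdgeColoredGraph G renaming (sym to adj-sym)
  open Extremal E

  d≥2 : 2 ≤ d
  d≥2 = ≮⇒≥ λ d<2 → <⇒≱ (≤-trans (s≤s (+-mono-≤ (+-mono-≤ 0<k 0<k) 0<k)) 3k<n)
    (≤-trans (m≤m+n n k) (≤-trans dense (≤-trans (+-mono-≤ (≤-pred d<2) (≤-pred d<2)) (s≤s (s≤s z≤n)))))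

  -- The hypotheses give 4n ≤ 6d ≤ 3n + 3k, hence n ≤ 3k.
  2n≰3d : d + d ≤ n + k → n + n ≤ d + d + d → ⊥
  2n≰3d 2d≤n+k 2n≤3d = <⇒≱ 3k<n (≤-from (n + n + n + (d + d + d) + (d + d + d))
    (+-mono-≤ (+-mono-≤ 2n≤3d 2n≤3d) (+-mono-≤ (+-mono-≤ 2d≤n+k 2d≤n+k) 2d≤n+k))
    (eq₁ n d) (eq₂ n d k))
    where
    eq₁ : ∀ n d → n + (n + n + n + (d + d + d) + (d + d + d)) ≡ n + n + (n + n) + (d + d + (d + d) + (d + d))
    eq₁ = solve-∀
    eq₂ : ∀ n d k → k + k + k + (n + n + n + (d + d + d) + (d + d + d)) ≡ d + d + d + (d + d + d) + (n + k + (n + k) + (n + k))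
    eq₂ = solve-∀

  -- A vertex shares all neighbours with each of its non-neighbours, so every vertex is adjacent to at
  -- least two vertices of any triangle.
  proper-case : s ≡ 0 → ∀ {w u} → Adj w u → ⊥
  proper-case refl {w} {u} w~u with Base.Q-inhabited G E w~u (self-mono G w~u) d≥2
  ... | y , y∈Q@(w~y , _) with count-∃⁻ (rainbow? G w y) (≤-trans 0<k (Base.k≤T G E w~u (self-mono G w~u) y∈Q))
  ...   | x , _ , y~x , w~x , _ = 2n≰3d (Base.2d≤n+k G E w~u (self-mono G w~u) y∈Q) (begin
    n + n ≤⟨ +-mono-≤ (cover w) (cover y) ⟩
    #non w + count (adj? w) + (#non y + count (adj? y)) ≡⟨ eq (#non w) (count (adj? w)) (#non y) (count (adj? y)) ⟩
    #non w + #non y + (count (adj? w) + count (adj? y))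
      -- By `twin` along the edges of the triangle, the non-neighbours of `w` and of `y`, each set
      -- including the vertex itself, are disjoint and all adjacent to `x`.
      ≤⟨ +-monoˡ-≤ (count (adj? w) + count (adj? y)) (count-disjoint (λ z → ¬? (adj? w z)) (λ z → ¬? (adj? y z)) (adj? x)
        (λ z w≁z → twin w~x w≁z) (λ z y≁z → twin y~x y≁z) λ z w≁z y≁z → y≁z (twin w~y w≁z)) ⟩
    count (adj? x) + (count (adj? w) + count (adj? y)) ≤⟨ +-mono-≤ (deg (adj-sym w~x)) (+-mono-≤ (deg w~y) (deg y~x)) ⟩
    d + (d + d) ≡⟨ +-assoc d d d ⟨
    d + d + d ∎)
    where
    open ≤-Reasoning
    #non : Fin n → ℕ
    #non v = count (λ z → ¬? (adj? v z))
    cover : ∀ v → n ≤ #non v + count (adj? v)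
    cover v = ≤-trans (≤-reflexive (sym (count-full {n} (λ z → ¬? (adj? v z) ⊎-dec adj? v z) dich)))
      (count-∪ (λ z → ¬? (adj? v z)) (adj? v))
      where
      dich : ∀ z → ¬ Adj v z ⊎ Adj v z
      dich z with adj? v z
      ... | yes v~z = inj₂ v~z
      ... | no v≁z = inj₁ v≁z
    eq : ∀ p q r t → p + q + (r + t) ≡ p + r + (q + t)
    eq = solve-∀
    twin : ∀ {v z t} → Adj v t → ¬ Adj v z → Adj t z
    twin {v} {z} v~t v≁z with z ≟ v
    ... | yes refl = adj-sym v~t
    ... | no z≢v with Base.Q-inhabited G E v~t (self-mono G v~t) d≥2
    -- For `s = 0` every single edge is a maximum star. Taking `vq` as the star, in a color other
    -- than that of `vt`, puts `t` among the other neighbours of `v`.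
    ...   | q , v~q , vq≢vt = proj₁ (Base.nonneighbour G E v~q (self-mono G v~q) (v~t , vq≢vt ∘ sym) z≢v v≁z)
    deg : ∀ {v t} → Adj v t → count (adj? v) ≤ d
    deg v~t = ≤-trans (Base.#neighbours≤d+s G E v~t (self-mono G v~t) (proj₂ (Base.Q-inhabited G E v~t (self-mono G v~t) d≥2)))
      (≤-reflexive (+-identityʳ d))

  module _ {w u : Fin n} (w~u : Adj w u) (full : suc s ≤ count (mono? G w (color w u))) where
    open Base G E w~u full

    -- Here all vertices lie in the closed neighbourhood of `w`, so n ≤ d + s + 1, and `2s≤d` turns
    -- this into 2n ≤ 3d.
    spanning-case : (∀ z → Adj w z ⊎ z ≡ w) → ∀ {y} → Q y → ⊥
    spanning-case all {y} y∈Q = 2n≰3d (2d≤n+k y∈Q) (begin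
      n + n ≤⟨ +-mono-≤ n≤ n≤ ⟩
      d + suc s + (d + suc s) ≡⟨ eq d (suc s) ⟩
      d + d + (suc s + suc s) ≤⟨ +-monoʳ-≤ (d + d) (2s≤d y∈Q) ⟩
      d + d + d ∎)
      where
      open ≤-Reasoning
      eq : ∀ d s → d + s + (d + s) ≡ d + d + (s + s)
      eq = solve-∀
      n≤ : n ≤ d + suc s
      n≤ = begin
        n ≡⟨ count-full (λ z → adj? w z ⊎-dec (z ≟ w)) all ⟨
        count (λ z → adj? w z ⊎-dec (z ≟ w)) ≤⟨ count-∪ (adj? w) (_≟ w) ⟩
        count (adj? w) + count (_≟ w) ≤⟨ +-mono-≤ (#neighbours≤d+s y∈Q) (≤-reflexive (count-≡ w)) ⟩
        d + s + 1 ≡⟨ +-assoc d s 1 ⟩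
        d + (s + 1) ≡⟨ cong (d +_) (+-comm s 1) ⟩
        d + suc s ∎

    -- All of Q lies in a single maximum monochromatic star centered at z, which is too small for that.
    nonneighbour-case : 0 < s → ∀ {z y₀} → z ≢ w → ¬ Adj w z → Q y₀ → ⊥
    nonneighbour-case 0<s {z} {y₀} z≢w w≁z y₀∈Q = <⇒≱ (s≤s 0<s) (≤-from (suc s) (begin
      suc s + suc s ≤⟨ 2s≤d y₀∈Q ⟩
      d ≤⟨ d≤#Q+1 ⟩
      count Q? + 1 ≤⟨ +-monoˡ-≤ 1 (count-mono Q? (mono? G z (color z y₀)) one-star) ⟩
      count (mono? G z (color z y₀)) + 1 ≤⟨ +-monoˡ-≤ 1 (bound z y₀ (z~ y₀∈Q)) ⟩
      suc s + 1 ∎) refl (+-comm 1 (suc s)))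
      where
      open ≤-Reasoning
      z~ : ∀ {y} → Q y → Adj z y
      z~ y∈Q = adj-sym (proj₁ (nonneighbour y∈Q z≢w w≁z))
      full-z : ∀ {y} → Q y → suc s ≤ count (mono? G z (color z y))
      -- Maximality passes from `w` to `y` and on to `z`. The second passage is allowed because
      -- `nonneighbour` gives `yz` a color other than that of `yw`.
      full-z {y} y∈Q = Base.full-y G E (adj-sym (proj₁ y∈Q)) (full-y y∈Q)
        (adj-sym (z~ y∈Q) , λ yz≡yw → proj₂ (nonneighbour y∈Q z≢w w≁z) (trans yz≡yw (color-sym y w)))
      one-star : ∀ y → Q y → Mono G z (color z y₀) y
      one-star y y∈Q with color z y ℕ.≟ color z y₀
      ... | yes zy≡zy₀ = z~ y∈Q , zy≡zy₀
      -- Relative to the maximum star through `y₀`, the edge `zy` would have a color occurring only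
      -- once at `z`, yet `full-z` gives that color at least two leaves.
      ... | no zy≢zy₀ with count-other (mono? G z (color z y)) (≤-trans (s≤s 0<s) (full-z y∈Q)) y
      ...   | x , x∈Mono , x≢y = ⊥-elim (x≢y (Base.unique-color G E (z~ y₀∈Q) (full-z y₀∈Q) (z~ y∈Q , zy≢zy₀) x∈Mono))

    extremal-impossible : ⊥
    extremal-impossible with Q-inhabited d≥2 | s ℕ.≟ 0 | any? (λ z → ¬? (z ≟ w) ×-dec ¬? (adj? w z))
    ... | _ | yes s≡0 | _ = proper-case s≡0 w~u
    ... | _ , y∈Q | no s≢0 | yes (_ , z≢w , w≁z) = nonneighbour-case (n≢0⇒n>0 s≢0) z≢w w≁z y∈Q
    ... | _ , y∈Q | no _ | no ∄z = spanning-case all y∈Q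
      where
      all : ∀ z → Adj w z ⊎ z ≡ w
      all z with adj? w z | z ≟ w
      ... | yes w~z | _ = inj₁ w~z
      ... | no _ | yes z≡w = inj₂ z≡w
      ... | no w≁z | no z≢w = ⊥-elim (∄z (z , z≢w , w≁z))

-- Deletion of redundant edges.

module _ {n : ℕ} (G : EdgeColoredGraph n) where
  open EdgeColoredGraph G renaming (sym to adj-sym)

  -- Counts ordered pairs, hence each edge twice; it is the measure for the descent.
  edges : ℕ
  edges = sum λ x → count (adj? x)

  doubled? : ∀ u v → Dec (Doubled G u v)
  doubled? u v = any? λ x → mono? G u (color u v) x ×-dec ¬? (x ≟ v)

  module _ (u v : Fin n) where

    IsEdge : Fin n → Fin n → Set
    IsEdge x y = (x ≡ u × y ≡ v) ⊎ (x ≡ v × y ≡ u)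

    isEdge? : ∀ x y → Dec (IsEdge x y)
    isEdge? x y = ((x ≟ u) ×-dec (y ≟ v)) ⊎-dec ((x ≟ v) ×-dec (y ≟ u))

    deleteEdge : EdgeColoredGraph n
    deleteEdge = record
      { graph = record
        { Adj = λ x y → Adj x y × ¬ IsEdge x y
        ; adj? = λ x y → adj? x y ×-dec ¬? (isEdge? x y)
        ; sym = λ { (x~y , xy≢uv) → adj-sym x~y
                  , λ { (inj₁ (p , q)) → xy≢uv (inj₂ (q , p)) ; (inj₂ (p , q)) → xy≢uv (inj₁ (q , p)) } }
        ; irrefl = irrefl ∘ proj₁
        }
      ; color = color
      ; color-sym = color-sym
      }

  rainbow-deleteEdge : ∀ {u v x y z} → RainbowTriangle (deleteEdge u v) x y z → RainbowTriangle G x y z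
  rainbow-deleteEdge ((x~y , _) , (y~z , _) , (x~z , _) , distinct) = x~y , y~z , x~z , distinct

  -- The color of `uv` survives at `u` on the edge to `x₁` and at `v` on the edge to `x₂`, so a set
  -- hitting all colors after the deletion also did so before.
  deleteEdge-counterexample : ∀ {u v d k} → Adj u v → Doubled G u v → Doubled G v u →
    Counterexample G d k → Counterexample (deleteEdge u v) d k
  deleteEdge-counterexample {u} {v} u~v (x₁ , (u~x₁ , ux₁≡uv) , x₁≢v) (x₂ , (v~x₂ , vx₂≡vu) , x₂≢u) C = record
    { degree = λ t B? hits → degree t B? (still-hits hits)
    ; few-rainbow = λ { x y (x~y , _) → ≤-trans
        (count-mono (rainbow? (deleteEdge u v) x y) (rainbow? G x y) λ _ → rainbow-deleteEdge) (few-rainbow x y x~y) }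
    }
    where
    open Counterexample C
    still-hits : ∀ {t B} → HitsColors (deleteEdge u v) t B → HitsColors G t B
    still-hits {t} hits x t~x with isEdge? u v t x
    ... | no tx≢uv = hits x (t~x , tx≢uv)
    ... | yes (inj₁ (refl , refl)) with hits x₁ (u~x₁ , [ x₁≢v ∘ proj₂ , (λ { (refl , _) → irrefl u~v }) ])
    ...   | y , y∈B , uy≡ux₁ = y , y∈B , trans uy≡ux₁ ux₁≡uv
    still-hits {t} hits x t~x | yes (inj₂ (refl , refl)) with hits x₂ (v~x₂ , [ (λ { (refl , _) → irrefl u~v }) , x₂≢u ∘ proj₂ ])
    ...   | y , y∈B , vy≡vx₂ = y , y∈B , trans vy≡vx₂ vx₂≡vu

edges-deleteEdge : ∀ {n} (G : EdgeColoredGraph n) {u v} → EdgeColoredGraph.Adj G u v → edges (deleteEdge G u v) < edges G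
edges-deleteEdge G {u} {v} u~v = ≰⇒> λ edges≤ → 1+n≰n (begin
  1 + count (adj′? u) ≡⟨ cong (_+ count (adj′? u)) (count-≡ v) ⟨
  count (_≟ v) + count (adj′? u) ≤⟨ count-disjoint (_≟ v) (adj′? u) (adj? u)
    (λ { _ refl → u~v }) (λ _ → proj₁) (λ { _ refl (_ , uv≢uv) → uv≢uv (inj₁ (refl , refl)) }) ⟩
  count (adj? u) ≤⟨ sum-tight (λ x → count-mono (adj′? x) (adj? x) λ _ → proj₁) edges≤ u ⟩
  count (adj′? u) ∎)
  where
  open ≤-Reasoning
  open EdgeColoredGraph G using (adj?)
  open EdgeColoredGraph (deleteEdge G u v) using () renaming (adj? to adj′?)

-- Descent to a reduced counterexample with a maximum star.

module _ {n d k : ℕ} (dense : n + k ≤ d + d) (0<k : 0 < k) (3k<n : k + k + k < n) where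

  -- Lowers the bound on star sizes until some star attains it; the given edge is itself a star of
  -- size at least 1, so this happens before 0.
  reduced-impossible : (G : EdgeColoredGraph n) → Counterexample G d k → let open EdgeColoredGraph G in
    (∀ u v → Adj u v → Doubled G u v → ¬ Doubled G v u) → ∀ {v u} → Adj v u →
    ∀ s → (∀ v u → Adj v u → count (mono? G v (color v u)) ≤ s) → ⊥
  reduced-impossible G C reduced {v} {u} v~u zero bound =
    <⇒≱ (self-mono G v~u) (bound v u v~u)
  reduced-impossible G C reduced v~u (suc s) bound
    with any? (λ w → any? λ t → EdgeColoredGraph.adj? G w t ×-dec (suc s ℕ.≤? count (mono? G w (EdgeColoredGraph.color G w t))))
  ... | yes (w , t , w~t , full) = extremal-impossible G
    (record { counterexample = C ; dense = dense ; reduced = reduced ; bound = bound }) 0<k 3k<n w~t full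
  ... | no ∄full = reduced-impossible G C reduced v~u s λ w t w~t → ≮⇒≥ λ full → ∄full (w , t , w~t , full)

  -- Without edges the empty neighbourhood would hit all colors, forcing d = 0 against `dense` and
  -- `0<k`.
  counterexample-has-edge : (G : EdgeColoredGraph n) → Counterexample G d k → ∃ λ v → ∃ (EdgeColoredGraph.Adj G v)
  counterexample-has-edge G C = decidable-stable (any? λ v → any? (adj? v)) λ no-edge →
    <⇒≱ 0<k (≤-trans (m≤n+m k n) (≤-trans dense (+-mono-≤ (d≤0 no-edge) (d≤0 no-edge))))
    where
    open EdgeColoredGraph G
    open Counterexample C
    vertex : Fin n
    vertex = fromℕ< (≤-trans (s≤s z≤n) 3k<n)
    d≤0 : ¬ (∃ λ v → ∃ (Adj v)) → d ≤ 0
    d≤0 no-edge = ≤-trans (degree vertex (adj? vertex) λ x v~x → x , v~x , refl)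
      (≤-reflexive (count-empty (adj? vertex) λ x v~x → no-edge (vertex , x , v~x)))

  no-counterexample : (G : EdgeColoredGraph n) → Acc _<_ (edges G) → ¬ Counterexample G d k
  no-counterexample G (acc rec) C with any? (λ u → any? λ v → adj? u v ×-dec doubled? G u v ×-dec doubled? G v u)
    where open EdgeColoredGraph G
  ... | yes (u , v , u~v , uv , vu) =
    no-counterexample (deleteEdge G u v) (rec (edges-deleteEdge G u~v)) (deleteEdge-counterexample G u~v uv vu C)
  ... | no reduced with counterexample-has-edge G C
  -- No star has more than `n` leaves, so the search for the maximum starts at `n`.
  ...   | _ , _ , v~u = reduced-impossible G C (λ u v u~v uv vu → reduced (u , v , u~v , uv , vu)) v~u n
    λ v u _ → ≤-trans (count-mono (mono? G v (EdgeColoredGraph.color G v u)) (λ _ → yes tt) _) (≤-reflexive (count-full (λ _ → yes tt) _))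

-- From color degrees to the theorem.

colorDegree≤count : ∀ {n} (G : EdgeColoredGraph n) v {B} (B? : ∀ x → Dec (B x)) → HitsColors G v B → colorDegree G v ≤ count B?
colorDegree≤count G v {B} B? hits = length-≤-count (color v) B? _ (deduplicate-! _) hit
  where
  open EdgeColoredGraph G
  hit : ∀ {a} → a ∈ deduplicate ℕ._≟_ (map (color v) (neighbours G v)) → ∃ λ x → B x × color v x ≡ a
  hit a∈ with ∈-map⁻ (color v) (∈-deduplicate⁻ ℕ._≟_ (map (color v) (neighbours G v)) a∈)
  ... | x , x∈N , refl = hits x (proj₂ (∈-filter⁻ (adj? v) {xs = allFin _} x∈N))

theorem3 : (k n : ℕ) → 2 ≤ k → 3 * k ∸ 2 ≤ n → (G : EdgeColoredGraph n) →
    ((v : Fin n) → n + k ∸ 1 ≤ 2 * colorDegree G v) →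
    Σ (Fin n) λ u → Σ (Fin n) λ v → Σ (Fin k → Fin n) λ w →
    EdgeColoredGraph.Adj G u v × Injective _≡_ _≡_ w ×
    ((i : Fin k) → RainbowTriangle G u v (w i))
-- From here on `k` is one less than in the theorem: an edge without `suc k` rainbow triangles lies
-- in at most `k`.
theorem3 (suc k) n (s≤s 0<k) 3k∸2≤n G δᶜ
  with any? (λ u → any? λ v → EdgeColoredGraph.adj? G u v ×-dec (suc k ℕ.≤? count (rainbow? G u v)))
... | yes (u , v , u~v , k<#T) with enumerate (rainbow? G u v) (suc k) k<#T
...   | w , w-inj , w-rainbow = u , v , w , u~v , w-inj , w-rainbow
theorem3 (suc k) n (s≤s 0<k) 3k∸2≤n G δᶜ | no ∄book =
  ⊥-elim (no-counterexample dense 0<k 3k<n G (<-wellFounded _) (record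
    { degree = λ v B? hits → ≤-trans (d≤colorDegree v) (colorDegree≤count G v B? hits)
    ; few-rainbow = λ u v u~v → ≮⇒≥ λ k<#T → ∄book (u , v , u~v , k<#T)
    }))
  where
  d : ℕ
  -- Color degrees are integers, so the bound may be rounded up; this gives `dense` for either
  -- parity.
  d = ⌈ n + k /2⌉
  dense : n + k ≤ d + d
  dense = ≤-trans (≤-reflexive (sym (⌊n/2⌋+⌈n/2⌉≡n (n + k)))) (+-monoˡ-≤ d (⌊n/2⌋≤⌈n/2⌉ (n + k)))
  3k<n : k + k + k < n
  3k<n = subst (λ m → m ∸ 2 ≤ n) (eq k) 3k∸2≤n
    where
    eq : ∀ k → 3 * suc k ≡ 3 + (k + k + k)
    eq = solve-∀
  d≤colorDegree : ∀ v → d ≤ colorDegree G v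
  d≤colorDegree v = begin
    ⌈ n + k /2⌉ ≤⟨ ⌈n/2⌉-mono (subst₂ _≤_ (cong (_∸ 1) (+-suc n k)) (cong (colorDegree G v +_) (+-identityʳ _)) (δᶜ v)) ⟩
    ⌈ colorDegree G v + colorDegree G v /2⌉ ≡⟨ n≡⌈n+n/2⌉ (colorDegree G v) ⟨
    colorDegree G v ∎
    where open ≤-Reasoning
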